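{- There is an absolute constant $c>0$ such that the following holds. Let $\delta>0$, let $\tau\ge1$ and $\ell\ge0$ be integers, $S_0>0$, $L>0$. Let $\mathcal U=[-\underline{\zeta},\overline{\zeta}]$ with $0<\underline{\zeta}\le1$, $\overline{\zeta}>0$ be the ordinary uncertainty set, and let $\mathcal W\subset[-1,\infty)$ be a compact interval of positive length (the jump uncertainty set). Let $g:\mathbb R\to\mathbb R$ be non-decreasing with $g(0)=0$ and $|g(x)-g(y)|\le L|x-y|$ for all $x,y$. Set $\epsilon=c\,\delta^2/(L^2\tau^2)$ and suppose that the lengths of $\mathcal U$ and $\mathcal W$ are integer multiples of $\epsilon$. Then the multinomial approximation $\hat g_0(S_0,\ell)$ with step $\epsilon$ of the price upper bound $g_0(S_0,\ell)$ in the adversarial jump model with at most $\ell$ jumps satisfies $$g_0(S_0,\ell)-\delta S_0\le\hat g_0(S_0,\ell)\le g_0(S_0,\ell).$$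
   Context: Adversarial jump model: over $\tau$ rounds the adversary chooses the return of each round. It may make at most $\ell$ jumps; in a jump round it chooses the return from $\mathcal W$, otherwise from $\mathcal U$. The price upper bound $g_t(x,m)$ at round $t$, with current price $x$ and $m$ remaining jumps, is defined by $g_\tau(x,m)=g(x)$ for all $m\ge0$ and, for $t=\tau-1,\dots,0$, $g_t(x,m)$ is the optimal value of the linear program in $(p,\Delta)\in\mathbb R^2$: minimize $p$ subject to $$g_{t+1}(x(1+r),m)-r\Delta\le p\quad\text{for all } r\in\mathcal U,$$ and, if $m\ge1$, $$g_{t+1}(x(1+r),m-1)-r\Delta\le p\quad\text{for all } r\in\mathcal W.$$ Approximation: let $\hat{\mathcal U}$ and $\hat{\mathcal W}$ be the finite grids of step $\epsilon$ in $\mathcal U$ and $\mathcal W$ respectively, starting at the left endpoint and ending at the right endpoint. The functions $\hat g_t(x,m)$ are defined by the same recursion, $\hat g_\tau(x,m)=g(x)$, with $\mathcal U,\mathcal W$ replaced by $\hat{\mathcal U},\hat{\mathcal W}$ and $g_{t+1}$ by $\hat g_{t+1}$. -}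

module Defs where

open import Data.Nat.Base as ℕ using (ℕ; suc)
import Data.Nat.Properties as ℕ
open import Data.Integer.Base using (+_)
open import Data.Rational.Base as ℚ using (ℚ; 0ℚ; 1ℚ; ½)
import Data.Rational.Properties as ℚ
open import Data.Rational.Solver using (module +-*-Solver)
open import Data.Product.Base using (∃-syntax; _×_; _,_; proj₁; proj₂)
open import Data.Sum.Base using (inj₁; inj₂)
open import Level using (0ℓ)
open import Relation.Binary.PropositionalEquality using (_≡_; refl; sym; trans; cong; cong₂; subst)
open import Relation.Unary using (Pred; _∈_)

-- The real numbers, as Cauchy sequences of rationals with setoid
-- equality _≃_ (two sequences are equal when their difference is null).

Eventually : Pred ℕ 0ℓ → Set
Eventually P = ∃[ N ] ∀ n → N ℕ.≤ n → P n

IsCauchy : (ℕ → ℚ) → Set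
IsCauchy s = ∀ e → 0ℚ ℚ.< e →
  ∃[ N ] ∀ m n → N ℕ.≤ m → N ℕ.≤ n → ℚ.∣ s m ℚ.- s n ∣ ℚ.≤ e

record ℝ : Set where
  constructor mkℝ
  field
    seq    : ℕ → ℚ
    cauchy : IsCauchy seq

open ℝ public

infix 4 _≃_ _≤_ _<_

_≃_ _≤_ _<_ : ℝ → ℝ → Set
x ≃ y = ∀ e → 0ℚ ℚ.< e → Eventually λ n → ℚ.∣ seq x n ℚ.- seq y n ∣ ℚ.≤ e
x ≤ y = ∀ e → 0ℚ ℚ.< e → Eventually λ n → seq x n ℚ.≤ seq y n ℚ.+ e
x < y = ∃[ e ] (0ℚ ℚ.< e × Eventually λ n → seq x n ℚ.+ e ℚ.≤ seq y n)

private
  abstract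
    ½-pos : ∀ {e} → 0ℚ ℚ.< e → 0ℚ ℚ.< ½ ℚ.* e
    ½-pos {e} 0<e = ℚ.positive⁻¹ _ {{ℚ.pos*pos⇒pos ½ e {{ℚ.positive 0<e}}}}

    ½+½ : ∀ e → ½ ℚ.* e ℚ.+ ½ ℚ.* e ≡ e
    ½+½ e = trans (sym (ℚ.*-distribʳ-+ e ½ ½)) (ℚ.*-identityˡ e)

    shrink : ∀ b e → 0ℚ ℚ.< b → 0ℚ ℚ.< e → ∃[ d ] (0ℚ ℚ.< d × b ℚ.* d ≡ e)
    shrink b e 0<b 0<e = b⁻¹ ℚ.* e , ℚ.positive⁻¹ (b⁻¹ ℚ.* e) {{ℚ.pos*pos⇒pos b⁻¹ e}} ,
        trans (sym (ℚ.*-assoc b b⁻¹ e))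
              (trans (cong (ℚ._* e) (ℚ.*-inverseʳ b)) (ℚ.*-identityˡ e))
      where
      instance
        b⁺ : ℚ.Positive b
        b⁺ = ℚ.positive 0<b
        e⁺ : ℚ.Positive e
        e⁺ = ℚ.positive 0<e
        b≢0 : ℚ.NonZero b
        b≢0 = ℚ.pos⇒nonZero b
      b⁻¹ : ℚ
      b⁻¹ = ℚ.1/ b
      instance
        b⁻¹⁺ : ℚ.Positive b⁻¹
        b⁻¹⁺ = ℚ.1/pos⇒pos b

    bounded : ∀ x → ∃[ b ] (0ℚ ℚ.< b × Eventually λ n → ℚ.∣ seq x n ∣ ℚ.≤ b)
    bounded x with cauchy x 1ℚ (ℚ.positive⁻¹ 1ℚ)
    ... | N , close = b , 0<b , N , λ n N≤n → begin
        ℚ.∣ s n ∣                       ≡⟨ cong ℚ.∣_∣ (split (s n) (s N)) ⟩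
        ℚ.∣ s N ℚ.+ (s n ℚ.- s N) ∣     ≤⟨ ℚ.∣p+q∣≤∣p∣+∣q∣ (s N) (s n ℚ.- s N) ⟩
        ℚ.∣ s N ∣ ℚ.+ ℚ.∣ s n ℚ.- s N ∣ ≤⟨ ℚ.+-monoʳ-≤ ℚ.∣ s N ∣ (close n N N≤n ℕ.≤-refl) ⟩
        b                               ∎
      where
      open ℚ.≤-Reasoning
      open +-*-Solver
      s : ℕ → ℚ
      s = seq x
      b : ℚ
      b = ℚ.∣ s N ∣ ℚ.+ 1ℚ
      0<b : 0ℚ ℚ.< b
      0<b = ℚ.+-mono-≤-< (ℚ.0≤∣p∣ (s N)) (ℚ.positive⁻¹ 1ℚ)
      split : ∀ p q → p ≡ q ℚ.+ (p ℚ.- q)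
      split = solve 2 (λ p q → p := q :+ (p :- q)) refl

    *-bound : ∀ p q {b d} → ℚ.∣ p ∣ ℚ.≤ b → ℚ.∣ q ∣ ℚ.≤ d → 0ℚ ℚ.< d →
              ℚ.∣ p ℚ.* q ∣ ℚ.≤ b ℚ.* d
    *-bound p q {b} {d} p≤b q≤d 0<d = begin
        ℚ.∣ p ℚ.* q ∣         ≡⟨ ℚ.∣p*q∣≡∣p∣*∣q∣ p q ⟩
        ℚ.∣ p ∣ ℚ.* ℚ.∣ q ∣   ≤⟨ ℚ.*-monoˡ-≤-nonNeg ℚ.∣ p ∣ {{ℚ.nonNegative (ℚ.0≤∣p∣ p)}} q≤d ⟩
        ℚ.∣ p ∣ ℚ.* d         ≤⟨ ℚ.*-monoʳ-≤-nonNeg d {{ℚ.nonNegative (ℚ.<⇒≤ 0<d)}} p≤b ⟩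
        b ℚ.* d               ∎
      where open ℚ.≤-Reasoning

    const-cauchy : ∀ q → IsCauchy (λ _ → q)
    const-cauchy q e 0<e = 0 , λ _ _ _ _ → begin
        ℚ.∣ q ℚ.- q ∣ ≡⟨ cong ℚ.∣_∣ (ℚ.+-inverseʳ q) ⟩
        0ℚ            ≤⟨ ℚ.<⇒≤ 0<e ⟩
        e             ∎
      where open ℚ.≤-Reasoning

    +-cauchy : ∀ x y → IsCauchy (λ n → seq x n ℚ.+ seq y n)
    +-cauchy x y = isCauchy
      where
      open +-*-Solver
      regroup : ∀ a b c d → (a ℚ.+ b) ℚ.- (c ℚ.+ d) ≡ (a ℚ.- c) ℚ.+ (b ℚ.- d)
      regroup = solve 4 (λ a b c d → (a :+ b) :- (c :+ d) := (a :- c) :+ (b :- d)) refl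
      isCauchy : IsCauchy (λ n → seq x n ℚ.+ seq y n)
      isCauchy e 0<e with cauchy x (½ ℚ.* e) (½-pos 0<e) | cauchy y (½ ℚ.* e) (½-pos 0<e)
      ... | M , cx | N , cy = M ℕ.⊔ N , λ m n h k → begin
          ℚ.∣ (seq x m ℚ.+ seq y m) ℚ.- (seq x n ℚ.+ seq y n) ∣
            ≡⟨ cong ℚ.∣_∣ (regroup (seq x m) (seq y m) (seq x n) (seq y n)) ⟩
          ℚ.∣ (seq x m ℚ.- seq x n) ℚ.+ (seq y m ℚ.- seq y n) ∣
            ≤⟨ ℚ.∣p+q∣≤∣p∣+∣q∣ (seq x m ℚ.- seq x n) (seq y m ℚ.- seq y n) ⟩
          ℚ.∣ seq x m ℚ.- seq x n ∣ ℚ.+ ℚ.∣ seq y m ℚ.- seq y n ∣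
            ≤⟨ ℚ.+-mono-≤ (cx m n (ℕ.m⊔n≤o⇒m≤o M N h) (ℕ.m⊔n≤o⇒m≤o M N k))
                          (cy m n (ℕ.m⊔n≤o⇒n≤o M N h) (ℕ.m⊔n≤o⇒n≤o M N k)) ⟩
          ½ ℚ.* e ℚ.+ ½ ℚ.* e ≡⟨ ½+½ e ⟩
          e                   ∎
        where open ℚ.≤-Reasoning

    neg-cauchy : ∀ x → IsCauchy (λ n → ℚ.- seq x n)
    neg-cauchy x = isCauchy
      where
      isCauchy : IsCauchy (λ n → ℚ.- seq x n)
      isCauchy e 0<e with cauchy x e 0<e
      ... | N , cx = N , λ m n h k → begin
          ℚ.∣ ℚ.- seq x m ℚ.- ℚ.- seq x n ∣   ≡⟨ cong ℚ.∣_∣ (ℚ.neg-distrib-+ (seq x m) (ℚ.- seq x n)) ⟨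
          ℚ.∣ ℚ.- (seq x m ℚ.- seq x n) ∣     ≡⟨ ℚ.∣-p∣≡∣p∣ (seq x m ℚ.- seq x n) ⟩
          ℚ.∣ seq x m ℚ.- seq x n ∣           ≤⟨ cx m n h k ⟩
          e                                   ∎
        where open ℚ.≤-Reasoning

    *-cauchy : ∀ x y → IsCauchy (λ n → seq x n ℚ.* seq y n)
    *-cauchy x y = isCauchy
      where
      open +-*-Solver
      regroup : ∀ a b c d → (a ℚ.* b) ℚ.- (c ℚ.* d) ≡ a ℚ.* (b ℚ.- d) ℚ.+ d ℚ.* (a ℚ.- c)
      regroup = solve 4 (λ a b c d → (a :* b) :- (c :* d) := a :* (b :- d) :+ d :* (a :- c)) refl
      close : ∀ a b c d {s t u v e} → s ℚ.* t ≡ ½ ℚ.* e → u ℚ.* v ≡ ½ ℚ.* e →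
              ℚ.∣ a ℚ.* (b ℚ.- d) ∣ ℚ.≤ s ℚ.* t → ℚ.∣ d ℚ.* (a ℚ.- c) ∣ ℚ.≤ u ℚ.* v →
              ℚ.∣ (a ℚ.* b) ℚ.- (c ℚ.* d) ∣ ℚ.≤ e
      close a b c d {s} {t} {u} {v} {e} s*t u*v h k = begin
          ℚ.∣ (a ℚ.* b) ℚ.- (c ℚ.* d) ∣                         ≡⟨ cong ℚ.∣_∣ (regroup a b c d) ⟩
          ℚ.∣ a ℚ.* (b ℚ.- d) ℚ.+ d ℚ.* (a ℚ.- c) ∣             ≤⟨ ℚ.∣p+q∣≤∣p∣+∣q∣ (a ℚ.* (b ℚ.- d)) (d ℚ.* (a ℚ.- c)) ⟩
          ℚ.∣ a ℚ.* (b ℚ.- d) ∣ ℚ.+ ℚ.∣ d ℚ.* (a ℚ.- c) ∣       ≤⟨ ℚ.+-mono-≤ h k ⟩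
          s ℚ.* t ℚ.+ u ℚ.* v                                   ≡⟨ cong₂ ℚ._+_ s*t u*v ⟩
          ½ ℚ.* e ℚ.+ ½ ℚ.* e                                   ≡⟨ ½+½ e ⟩
          e                                                     ∎
        where open ℚ.≤-Reasoning
      combine : ∀ e b → Eventually (λ n → ℚ.∣ seq x n ∣ ℚ.≤ b) →
                ∀ d → Eventually (λ n → ℚ.∣ seq y n ∣ ℚ.≤ d) →
                ∀ u → 0ℚ ℚ.< u → b ℚ.* u ≡ ½ ℚ.* e →
                ∀ v → 0ℚ ℚ.< v → d ℚ.* v ≡ ½ ℚ.* e →
                ∃[ N ] ∀ m n → N ℕ.≤ m → N ℕ.≤ n →
                  ℚ.∣ (seq x m ℚ.* seq y m) ℚ.- (seq x n ℚ.* seq y n) ∣ ℚ.≤ e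
      combine e b (M , bx) d (N , by) u 0<u b*u v 0<v d*v =
        K , λ m n h k →
          close (seq x m) (seq y m) (seq x n) (seq y n) {b} {u} {d} {v} b*u d*v
            (*-bound (seq x m) (seq y m ℚ.- seq y n) {b} {u} (bx m (atM h))
              (proj₂ cy m n (atP h) (atP k)) 0<u)
            (*-bound (seq y n) (seq x m ℚ.- seq x n) {d} {v} (by n (atN k))
              (proj₂ cx m n (atQ h) (atQ k)) 0<v)
        where
        cy : ∃[ P ] ∀ m n → P ℕ.≤ m → P ℕ.≤ n → ℚ.∣ seq y m ℚ.- seq y n ∣ ℚ.≤ u
        cy = cauchy y u 0<u
        cx : ∃[ Q ] ∀ m n → Q ℕ.≤ m → Q ℕ.≤ n → ℚ.∣ seq x m ℚ.- seq x n ∣ ℚ.≤ v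
        cx = cauchy x v 0<v
        P Q K : ℕ
        P = proj₁ cy
        Q = proj₁ cx
        K = (M ℕ.⊔ N) ℕ.⊔ (P ℕ.⊔ Q)
        atM : ∀ {n} → K ℕ.≤ n → M ℕ.≤ n
        atM h = ℕ.m⊔n≤o⇒m≤o M N (ℕ.m⊔n≤o⇒m≤o (M ℕ.⊔ N) (P ℕ.⊔ Q) h)
        atN : ∀ {n} → K ℕ.≤ n → N ℕ.≤ n
        atN h = ℕ.m⊔n≤o⇒n≤o M N (ℕ.m⊔n≤o⇒m≤o (M ℕ.⊔ N) (P ℕ.⊔ Q) h)
        atP : ∀ {n} → K ℕ.≤ n → P ℕ.≤ n
        atP h = ℕ.m⊔n≤o⇒m≤o P Q (ℕ.m⊔n≤o⇒n≤o (M ℕ.⊔ N) (P ℕ.⊔ Q) h)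
        atQ : ∀ {n} → K ℕ.≤ n → Q ℕ.≤ n
        atQ h = ℕ.m⊔n≤o⇒n≤o P Q (ℕ.m⊔n≤o⇒n≤o (M ℕ.⊔ N) (P ℕ.⊔ Q) h)
      split : ∀ e → 0ℚ ℚ.< e →
              ∃[ b ] (0ℚ ℚ.< b × Eventually λ n → ℚ.∣ seq x n ∣ ℚ.≤ b) →
              ∃[ d ] (0ℚ ℚ.< d × Eventually λ n → ℚ.∣ seq y n ∣ ℚ.≤ d) →
              ∃[ N ] ∀ m n → N ℕ.≤ m → N ℕ.≤ n →
                ℚ.∣ (seq x m ℚ.* seq y m) ℚ.- (seq x n ℚ.* seq y n) ∣ ℚ.≤ e
      split e 0<e (b , 0<b , bx) (d , 0<d , by) =
        combine e b bx d by
          (proj₁ su) (proj₁ (proj₂ su)) (proj₂ (proj₂ su))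
          (proj₁ sv) (proj₁ (proj₂ sv)) (proj₂ (proj₂ sv))
        where
        su : ∃[ u ] (0ℚ ℚ.< u × b ℚ.* u ≡ ½ ℚ.* e)
        su = shrink b (½ ℚ.* e) 0<b (½-pos 0<e)
        sv : ∃[ v ] (0ℚ ℚ.< v × d ℚ.* v ≡ ½ ℚ.* e)
        sv = shrink d (½ ℚ.* e) 0<d (½-pos 0<e)
      isCauchy : IsCauchy (λ n → seq x n ℚ.* seq y n)
      isCauchy e 0<e = split e 0<e (bounded x) (bounded y)

    abs-cauchy : ∀ x → IsCauchy (λ n → ℚ.∣ seq x n ∣)
    abs-cauchy x = isCauchy
      where
      open +-*-Solver
      split : ∀ p q → p ≡ q ℚ.+ (p ℚ.- q)
      split = solve 2 (λ p q → p := q :+ (p :- q)) refl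
      cancel : ∀ p q → (p ℚ.+ q) ℚ.- p ≡ q
      cancel = solve 2 (λ p q → (p :+ q) :- p := q) refl
      open ℚ.≤-Reasoning
      half : ∀ p q e → ℚ.∣ p ℚ.- q ∣ ℚ.≤ e → ℚ.∣ p ∣ ℚ.- ℚ.∣ q ∣ ℚ.≤ e
      half p q e h = begin
        ℚ.∣ p ∣ ℚ.- ℚ.∣ q ∣                           ≡⟨ cong (λ z → ℚ.∣ z ∣ ℚ.- ℚ.∣ q ∣) (split p q) ⟩
        ℚ.∣ q ℚ.+ (p ℚ.- q) ∣ ℚ.- ℚ.∣ q ∣             ≤⟨ ℚ.+-monoˡ-≤ (ℚ.- ℚ.∣ q ∣) (ℚ.∣p+q∣≤∣p∣+∣q∣ q (p ℚ.- q)) ⟩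
        (ℚ.∣ q ∣ ℚ.+ ℚ.∣ p ℚ.- q ∣) ℚ.- ℚ.∣ q ∣       ≡⟨ cancel ℚ.∣ q ∣ ℚ.∣ p ℚ.- q ∣ ⟩
        ℚ.∣ p ℚ.- q ∣                                 ≤⟨ h ⟩
        e                                             ∎
      swap : ∀ p q → p ℚ.- q ≡ ℚ.- (q ℚ.- p)
      swap = solve 2 (λ p q → p :- q := :- (q :- p)) refl
      abs-≤ : ∀ p q {e} → p ℚ.- q ℚ.≤ e → q ℚ.- p ℚ.≤ e → ℚ.∣ p ℚ.- q ∣ ℚ.≤ e
      abs-≤ p q {e} h k with ℚ.∣p∣≡p∨∣p∣≡-p (p ℚ.- q)
      ... | inj₁ eq = subst (ℚ._≤ e) (sym eq) h
      ... | inj₂ eq = subst (ℚ._≤ e) (sym (trans eq (sym (swap q p)))) k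
      isCauchy : IsCauchy (λ n → ℚ.∣ seq x n ∣)
      isCauchy e 0<e with cauchy x e 0<e
      ... | N , cx = N , λ m n h k →
        abs-≤ ℚ.∣ seq x m ∣ ℚ.∣ seq x n ∣
          (half (seq x m) (seq x n) e (cx m n h k))
          (half (seq x n) (seq x m) e (cx n m k h))

infixl 6 _+_ _-_
infixl 7 _*_
infix  8 -_

fromℚ : ℚ → ℝ
fromℚ q = mkℝ (λ _ → q) (const-cauchy q)

fromℕ : ℕ → ℝ
fromℕ n = fromℚ (+ n ℚ./ 1)

0ℝ 1ℝ : ℝ
0ℝ = fromℚ 0ℚ
1ℝ = fromℚ 1ℚ

_+_ : ℝ → ℝ → ℝ
x + y = mkℝ (λ n → seq x n ℚ.+ seq y n) (+-cauchy x y)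

-_ : ℝ → ℝ
- x = mkℝ (λ n → ℚ.- seq x n) (neg-cauchy x)

_-_ : ℝ → ℝ → ℝ
x - y = x + - y

_*_ : ℝ → ℝ → ℝ
x * y = mkℝ (λ n → seq x n ℚ.* seq y n) (*-cauchy x y)

∣_∣ : ℝ → ℝ
∣ x ∣ = mkℝ (λ n → ℚ.∣ seq x n ∣) (abs-cauchy x)

Interval : ℝ → ℝ → Pred ℝ 0ℓ
Interval a b r = a ≤ r × r ≤ b

-- For ε > 0 this is the finite set {a, a + ε, a + 2ε, …} ∩ [a , b]; it
-- ends at b when b - a is a multiple of ε.
Grid : ℝ → ℝ → ℝ → Pred ℝ 0ℓ
Grid ε a b r = r ∈ Interval a b × ∃[ i ] r ≃ a + fromℕ i * ε

IsMultipleOf : ℝ → ℝ → Set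
IsMultipleOf ε x = ∃[ k ] x ≃ fromℕ k * ε

IsInfimum : Pred ℝ 0ℓ → ℝ → Set
IsInfimum S v = (∀ p → p ∈ S → v ≤ p) × (∀ u → (∀ p → p ∈ S → u ≤ p) → u ≤ v)

-- V t x m is a price bound at round t for current price x and m remaining
-- jumps; the constraints at round t refer to round t + 1.
Feasible : (U W : Pred ℝ 0ℓ) (V : ℕ → ℝ → ℕ → ℝ) →
           ℕ → ℝ → ℕ → (p Δ : ℝ) → Set
Feasible U W V t x m p Δ =
  (∀ r → r ∈ U → V (suc t) (x * (1ℝ + r)) m - r * Δ ≤ p) ×
  (1 ℕ.≤ m → ∀ r → r ∈ W → V (suc t) (x * (1ℝ + r)) (m ℕ.∸ 1) - r * Δ ≤ p)

-- The backward recursion determines V t x m uniquely up to _≃_ for t ≤ τ;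
-- values at t > τ are unconstrained and play no role.
record IsPriceBound (τ : ℕ) (g : ℝ → ℝ) (U W : Pred ℝ 0ℓ)
                    (V : ℕ → ℝ → ℕ → ℝ) : Set where
  field
    terminal : ∀ x m → V τ x m ≃ g x
    optimal  : ∀ t → t ℕ.< τ → ∀ x m →
               IsInfimum (λ p → ∃[ Δ ] Feasible U W V t x m p Δ) (V t x m)

{-# OPTIONS --safe #-}
module Submission where

-- With c = 1.  Each G_t(·, m) is L-Lipschitz, because a feasible (p, Δ) for
-- the price y gives the feasible (p + L d, Δ + L d) for any price x with
-- |x - y| ≤ d.  A constraint at r ∈ 𝒰 or 𝒲 follows, up to an error L ε x,
-- from the one at the grid neighbour of r on the side where r Δ does not
-- increase p.  As x (1 + r) is affine in r, these errors are absorbed into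
-- (p, Δ) in the earlier rounds, whence G ≤ Ĝ + τ L ε S₀.  If δ ≤ L τ then
-- τ L ε = δ² / (L τ) ≤ δ; otherwise 0 ≤ Ĝ and G ≤ L S₀ ≤ δ S₀ suffice.
-- The bound Ĝ ≤ G holds because the grids carry fewer constraints.

open import Defs
open import Data.Nat.Base as ℕ using (ℕ; zero; suc)
import Data.Nat.Coprimality as Coprimality
import Data.Nat.Properties as ℕ
open import Data.Integer.Base as ℤ using (+_)
import Data.Integer.Properties as ℤ
open import Data.Rational.Base as ℚ using (ℚ; mkℚ; 0ℚ; 1ℚ)
import Data.Rational.Properties as ℚ
open import Data.Rational.Solver using (module +-*-Solver)
open import Data.Empty using (⊥-elim)
open import Data.Product.Base using (_×_; _,_; ∃-syntax; proj₁; proj₂)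
open import Data.Sum.Base using (_⊎_; inj₁; inj₂; [_,_]′)
open import Relation.Binary.PropositionalEquality
  using (_≡_; refl; sym; trans; cong; subst)
open import Relation.Nullary using (¬_; yes; no)
open import Relation.Unary using (Pred; _∈_; _⊆_)
open +-*-Solver using (solve; _:+_; _:*_; _:-_; :-_; _:=_; con)

-- Ordered field facts for ℝ

eventually-∩ : ∀ {P Q : ℕ → Set} → Eventually P → Eventually Q →
               Eventually λ n → P n × Q n
eventually-∩ (M , p) (N , q) = M ℕ.⊔ N , λ n h →
  p n (ℕ.m⊔n≤o⇒m≤o M N h) , q n (ℕ.m⊔n≤o⇒n≤o M N h)

eventually-map : ∀ {P Q : ℕ → Set} → (∀ n → P n → Q n) → Eventually P → Eventually Q
eventually-map f (N , p) = N , λ n h → f n (p n h)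

-- The quotient is given by the equation it solves: the ring solver knows no division, and matching
-- the equation with `refl` turns `e` into a polynomial in `d`.
ℚ-quotient : ∀ b e → 0ℚ ℚ.< b → 0ℚ ℚ.< e → ∃[ d ] (0ℚ ℚ.< d × b ℚ.* d ≡ e)
ℚ-quotient b e 0<b 0<e =
  ℚ.1/ b ℚ.* e ,
  ℚ.positive⁻¹ _ {{ℚ.pos*pos⇒pos (ℚ.1/ b) {{ℚ.1/pos⇒pos b}} e}} ,
  trans (sym (ℚ.*-assoc b (ℚ.1/ b) e))
        (trans (cong (ℚ._* e) (ℚ.*-inverseʳ b)) (ℚ.*-identityˡ e))
  where
  instance
    b⁺ : ℚ.Positive b
    b⁺ = ℚ.positive 0<b
    e⁺ : ℚ.Positive e
    e⁺ = ℚ.positive 0<e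
    b≢0 : ℚ.NonZero b
    b≢0 = ℚ.pos⇒nonZero b

ℚ-halve : ∀ e → 0ℚ ℚ.< e → ∃[ d ] (0ℚ ℚ.< d × d ℚ.+ d ≡ e)
ℚ-halve e 0<e with ℚ-quotient (1ℚ ℚ.+ 1ℚ) e (ℚ.positive⁻¹ _) 0<e
... | d , 0<d , refl =
  d , 0<d , solve 1 (λ d → d :+ d := con (1ℚ ℚ.+ 1ℚ) :* d) refl d

ℚ-0≤q-p : ∀ {p q} → p ℚ.≤ q → 0ℚ ℚ.≤ q ℚ.- p
ℚ-0≤q-p {p} {q} p≤q =
  subst (ℚ._≤ q ℚ.- p) (ℚ.+-inverseʳ p) (ℚ.+-monoˡ-≤ (ℚ.- p) p≤q)

ℚ-≤-by : ∀ {p q s} → 0ℚ ℚ.≤ s → q ≡ p ℚ.+ s → p ℚ.≤ q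
ℚ-≤-by {p} {_} {s} 0≤s refl =
  subst (ℚ._≤ p ℚ.+ s) (ℚ.+-identityʳ p) (ℚ.+-monoʳ-≤ p 0≤s)

ℚ-*-nonneg : ∀ {p q} → 0ℚ ℚ.≤ p → 0ℚ ℚ.≤ q → 0ℚ ℚ.≤ p ℚ.* q
ℚ-*-nonneg {p} {q} 0≤p 0≤q =
  subst (ℚ._≤ p ℚ.* q) (ℚ.*-zeroʳ p) (ℚ.*-monoˡ-≤-nonNeg p {{ℚ.nonNegative 0≤p}} 0≤q)

ℚ-+-nonneg : ∀ {p q} → 0ℚ ℚ.≤ p → 0ℚ ℚ.≤ q → 0ℚ ℚ.≤ p ℚ.+ q
ℚ-+-nonneg = ℚ.+-mono-≤ {0ℚ} {_} {0ℚ}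

p≤∣p∣ : ∀ p → p ℚ.≤ ℚ.∣ p ∣
p≤∣p∣ p with ℚ.≤-total 0ℚ p
... | inj₁ 0≤p = ℚ.≤-reflexive (sym (ℚ.0≤p⇒∣p∣≡p 0≤p))
... | inj₂ p≤0 = ℚ.≤-trans p≤0 (ℚ.0≤∣p∣ p)

∣p-q∣≤e⇒p≤q+e : ∀ {p q e} → ℚ.∣ p ℚ.- q ∣ ℚ.≤ e → p ℚ.≤ q ℚ.+ e
∣p-q∣≤e⇒p≤q+e {p} {q} {e} h =
  ℚ-≤-by (ℚ-0≤q-p (ℚ.≤-trans (p≤∣p∣ (p ℚ.- q)) h))
    (solve 3 (λ p q e → q :+ e := p :+ (e :- (p :- q))) refl p q e)

∣p-q∣≤e⇒q≤p+e : ∀ {p q e} → ℚ.∣ p ℚ.- q ∣ ℚ.≤ e → q ℚ.≤ p ℚ.+ e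
∣p-q∣≤e⇒q≤p+e {p} {q} h = ∣p-q∣≤e⇒p≤q+e {q} {p}
  (subst (ℚ._≤ _)
    (trans (sym (ℚ.∣-p∣≡∣p∣ (p ℚ.- q)))
           (cong ℚ.∣_∣ (solve 2 (λ p q → :- (p :- q) := q :- p) refl p q))) h)

-- x ≤ y unfolds to a Π-type, from which x and y cannot be inferred; the
-- record keeps the real number visible to unification.
record NonNeg (x : ℝ) : Set where
  constructor nonNeg
  field
    0≤ : 0ℝ ≤ x

open NonNeg

-- Inequalities are proved by exhibiting y - x as a sum of products of
-- nonnegative reals; the identity holds termwise for rational sequences.
≤-by : ∀ x y {s} → NonNeg s → (∀ n → seq y n ≡ seq x n ℚ.+ seq s n) → x ≤ y
≤-by x y {s} (nonNeg 0≤s) eq e 0<e = eventually-map step (0≤s e 0<e)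
  where
  step : ∀ n → 0ℚ ℚ.≤ seq s n ℚ.+ e → seq x n ℚ.≤ seq y n ℚ.+ e
  step n h = ℚ-≤-by h (trans (cong (ℚ._+ e) (eq n)) (ℚ.+-assoc (seq x n) (seq s n) e))

diff : ∀ x y → x ≤ y → NonNeg (y - x)
diff x y x≤y = nonNeg λ e 0<e → eventually-map (step e) (x≤y e 0<e)
  where
  step : ∀ e n → seq x n ℚ.≤ seq y n ℚ.+ e → 0ℚ ℚ.≤ (seq y n ℚ.- seq x n) ℚ.+ e
  step e n h = subst (0ℚ ℚ.≤_)
    (solve 3 (λ x y e → (y :+ e) :- x := (y :- x) :+ e) refl (seq x n) (seq y n) e)
    (ℚ-0≤q-p h)

≃⇒≤ : ∀ x y → x ≃ y → x ≤ y
≃⇒≤ x y x≃y e 0<e =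
  eventually-map (λ n → ∣p-q∣≤e⇒p≤q+e {seq x n} {seq y n}) (x≃y e 0<e)

≃⇒≥ : ∀ x y → x ≃ y → y ≤ x
≃⇒≥ x y x≃y e 0<e =
  eventually-map (λ n → ∣p-q∣≤e⇒q≤p+e {seq x n} {seq y n}) (x≃y e 0<e)

≗⇒≃ : ∀ x y → (∀ n → seq x n ≡ seq y n) → x ≃ y
≗⇒≃ x y eq e 0<e = 0 , λ n _ → subst (λ q → ℚ.∣ q ℚ.- seq y n ∣ ℚ.≤ e) (sym (eq n))
  (subst (ℚ._≤ e) (cong ℚ.∣_∣ (sym (ℚ.+-inverseʳ (seq y n)))) (ℚ.<⇒≤ 0<e))

≤-refl : ∀ x → x ≤ x
≤-refl x = ≃⇒≤ x x (≗⇒≃ x x λ _ → refl)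

<⇒≤ : ∀ x y → x < y → x ≤ y
<⇒≤ x y (d , 0<d , h) e 0<e = eventually-map step h
  where
  step : ∀ n → seq x n ℚ.+ d ℚ.≤ seq y n → seq x n ℚ.≤ seq y n ℚ.+ e
  step n k = ℚ.≤-trans (ℚ-≤-by (ℚ.<⇒≤ 0<d) refl) (ℚ.≤-trans k (ℚ-≤-by (ℚ.<⇒≤ 0<e) refl))

infixl 6 _⊕_
infixl 7 _⊛_

_⊕_ : ∀ {x y} → NonNeg x → NonNeg y → NonNeg (x + y)
_⊕_ {x} {y} (nonNeg 0≤x) (nonNeg 0≤y) = nonNeg 0≤x+y
  where
  0≤x+y : 0ℝ ≤ x + y
  0≤x+y e 0<e with ℚ-halve e 0<e
  ... | d , 0<d , refl = eventually-map step (eventually-∩ (0≤x d 0<d) (0≤y d 0<d))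
    where
    step : ∀ n → 0ℚ ℚ.≤ seq x n ℚ.+ d × 0ℚ ℚ.≤ seq y n ℚ.+ d →
           0ℚ ℚ.≤ (seq x n ℚ.+ seq y n) ℚ.+ (d ℚ.+ d)
    step n (h , k) = subst (0ℚ ℚ.≤_)
      (solve 3 (λ x y d → (x :+ d) :+ (y :+ d) := (x :+ y) :+ (d :+ d)) refl (seq x n) (seq y n) d)
      (ℚ-+-nonneg h k)

≤-trans : ∀ x y z → x ≤ y → y ≤ z → x ≤ z
≤-trans x y z x≤y y≤z = ≤-by x z (diff x y x≤y ⊕ diff y z y≤z) λ n →
  solve 3 (λ x y z → z := x :+ ((y :- x) :+ (z :- y))) refl (seq x n) (seq y n) (seq z n)

eventually-bounded : ∀ x → ∃[ b ] (0ℚ ℚ.< b × Eventually λ n → seq x n ℚ.≤ b)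
eventually-bounded x with cauchy x 1ℚ (ℚ.positive⁻¹ 1ℚ)
... | N , close = ℚ.∣ seq x N ∣ ℚ.+ 1ℚ ,
  ℚ.+-mono-≤-< (ℚ.0≤∣p∣ (seq x N)) (ℚ.positive⁻¹ 1ℚ) ,
  N , λ n N≤n → ℚ.≤-trans (∣p-q∣≤e⇒p≤q+e {seq x n} {seq x N} (close n N N≤n ℕ.≤-refl))
                          (ℚ.+-monoˡ-≤ 1ℚ (p≤∣p∣ (seq x N)))

-- Rational core of `_⊛_`. Factors of equal sign are harmless. If `p ≤ 0 ≤ q`, then `p * q + b * d`
-- equals `(p + d) * q + d * (b - q)`, a sum of two nonnegative terms; the other mixed case is
-- symmetric, with `a` and `c`.
ℚ-*-almost-nonneg : ∀ {a b c d e} p q → 0ℚ ℚ.< c → 0ℚ ℚ.< d → 0ℚ ℚ.< e →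
  b ℚ.* d ≡ e → a ℚ.* c ≡ e → 0ℚ ℚ.≤ p ℚ.+ d → 0ℚ ℚ.≤ q ℚ.+ c →
  p ℚ.≤ a → q ℚ.≤ b → 0ℚ ℚ.≤ p ℚ.* q ℚ.+ e
ℚ-*-almost-nonneg {a} {b} {c} {d} {e} p q 0<c 0<d 0<e bd≡e ac≡e hp hq p≤a q≤b
  with ℚ.≤-total 0ℚ p | ℚ.≤-total 0ℚ q
... | inj₁ 0≤p | inj₁ 0≤q = ℚ-+-nonneg (ℚ-*-nonneg 0≤p 0≤q) (ℚ.<⇒≤ 0<e)
... | inj₂ p≤0 | inj₂ q≤0 = ℚ-+-nonneg
  (subst (0ℚ ℚ.≤_) (solve 2 (λ p q → (con 0ℚ :- p) :* (con 0ℚ :- q) := p :* q) refl p q)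
    (ℚ-*-nonneg (ℚ-0≤q-p p≤0) (ℚ-0≤q-p q≤0)))
  (ℚ.<⇒≤ 0<e)
... | inj₂ p≤0 | inj₁ 0≤q = subst (0ℚ ℚ.≤_)
  (trans (solve 4 (λ p q b d → (p :+ d) :* q :+ d :* (b :- q) := p :* q :+ b :* d) refl p q b d)
         (cong (p ℚ.* q ℚ.+_) bd≡e))
  (ℚ-+-nonneg (ℚ-*-nonneg hp 0≤q) (ℚ-*-nonneg (ℚ.<⇒≤ 0<d) (ℚ-0≤q-p q≤b)))
... | inj₁ 0≤p | inj₂ q≤0 = subst (0ℚ ℚ.≤_)
  (trans (solve 4 (λ p q a c → (q :+ c) :* p :+ c :* (a :- p) := p :* q :+ a :* c) refl p q a c)
         (cong (p ℚ.* q ℚ.+_) ac≡e))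
  (ℚ-+-nonneg (ℚ-*-nonneg hq 0≤p) (ℚ-*-nonneg (ℚ.<⇒≤ 0<c) (ℚ-0≤q-p p≤a)))

_⊛_ : ∀ {x y} → NonNeg x → NonNeg y → NonNeg (x * y)
_⊛_ {x} {y} (nonNeg 0≤x) (nonNeg 0≤y) = nonNeg 0≤xy
  where
  0≤xy : 0ℝ ≤ x * y
  0≤xy e 0<e =
    let a , 0<a , x≤a = eventually-bounded x
        b , 0<b , y≤b = eventually-bounded y
        d , 0<d , bd≡e = ℚ-quotient b e 0<b 0<e
        c , 0<c , ac≡e = ℚ-quotient a e 0<a 0<e
    in eventually-map
         (λ n ((hx , hy) , (kx , ky)) →
           ℚ-*-almost-nonneg (seq x n) (seq y n) 0<c 0<d 0<e bd≡e ac≡e hx hy kx ky)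
         (eventually-∩ (eventually-∩ (0≤x d 0<d) (0≤y c 0<c)) (eventually-∩ x≤a y≤b))

-- Nothing in ℝ is inverted. Positivity of `x` supplies a rational `d` with `d ≤ seq x n` for late
-- `n`; the hypothesis is used at tolerance `d * e`, which is at most `seq x n * e`, so the rational
-- factor `seq x n` cancels.
*-cancelˡ-≤ : ∀ x y z → 0ℝ < x → x * y ≤ x * z → y ≤ z
*-cancelˡ-≤ x y z (d , 0<d , d≤x) xy≤xz e 0<e =
  eventually-map step (eventually-∩ d≤x (xy≤xz (d ℚ.* e) 0<de))
  where
  0<de : 0ℚ ℚ.< d ℚ.* e
  0<de = ℚ.positive⁻¹ _ {{ℚ.pos*pos⇒pos d {{ℚ.positive 0<d}} e {{ℚ.positive 0<e}}}}
  step : ∀ n → 0ℚ ℚ.+ d ℚ.≤ seq x n × seq x n ℚ.* seq y n ℚ.≤ seq x n ℚ.* seq z n ℚ.+ d ℚ.* e →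
         seq y n ℚ.≤ seq z n ℚ.+ e
  step n (h , k) = ℚ.*-cancelˡ-≤-pos (seq x n) {{ℚ.positive (ℚ.<-≤-trans 0<d d≤xₙ)}}
    (ℚ.≤-trans k (ℚ-≤-by (ℚ-*-nonneg (ℚ-0≤q-p d≤xₙ) (ℚ.<⇒≤ 0<e))
      (solve 4 (λ x z d e → x :* (z :+ e) := (x :* z :+ d :* e) :+ (x :- d) :* e) refl
        (seq x n) (seq z n) d e)))
    where
    d≤xₙ : d ℚ.≤ seq x n
    d≤xₙ = subst (ℚ._≤ seq x n) (ℚ.+-identityˡ d) h

-- A single rational comparison far out in both sequences decides the
-- alternative.
≤+e-or-> : ∀ x y e → 0ℚ ℚ.< e → Eventually (λ n → seq x n ℚ.≤ seq y n ℚ.+ e) ⊎ (y < x)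
-- With `e = 5 d`, the sequences are compared at one index with threshold `3 d`, and beyond it each
-- moves by at most `d`. A positive answer loses `2 d` and gives the tolerance `5 d`; a negative one
-- keeps a gap of `d`.
≤+e-or-> x y e 0<e with ℚ-quotient (+ 5 ℚ./ 1) e (ℚ.positive⁻¹ _) 0<e
... | d , 0<d , refl with cauchy x d 0<d | cauchy y d 0<d
...   | M , cx | N , cy with seq x (M ℕ.⊔ N) ℚ.≤? seq y (M ℕ.⊔ N) ℚ.+ (d ℚ.+ d ℚ.+ d)
...     | yes h = inj₁ (K , λ n K≤n →
  let x≤ = ℚ-0≤q-p (∣p-q∣≤e⇒p≤q+e {seq x n} {seq x K} (cx n K (ℕ.m⊔n≤o⇒m≤o M N K≤n) (ℕ.m≤m⊔n M N)))
      y≥ = ℚ-0≤q-p (∣p-q∣≤e⇒q≤p+e {seq y n} {seq y K} (cy n K (ℕ.m⊔n≤o⇒n≤o M N K≤n) (ℕ.m≤n⊔m M N)))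
  in ℚ-≤-by (ℚ-+-nonneg (ℚ-+-nonneg x≤ y≥) (ℚ-0≤q-p h))
    (solve 5 (λ x x′ y y′ d →
        y :+ con (+ 5 ℚ./ 1) :* d :=
        x :+ (((x′ :+ d) :- x) :+ ((y :+ d) :- y′) :+ ((y′ :+ (d :+ d :+ d)) :- x′)))
      refl (seq x n) (seq x K) (seq y n) (seq y K) d))
  where
  K : ℕ
  K = M ℕ.⊔ N
...     | no ¬h = inj₂ (d , 0<d , K , λ n K≤n →
  let x≥ = ℚ-0≤q-p (∣p-q∣≤e⇒q≤p+e {seq x n} {seq x K} (cx n K (ℕ.m⊔n≤o⇒m≤o M N K≤n) (ℕ.m≤m⊔n M N)))
      y≤ = ℚ-0≤q-p (∣p-q∣≤e⇒p≤q+e {seq y n} {seq y K} (cy n K (ℕ.m⊔n≤o⇒n≤o M N K≤n) (ℕ.m≤n⊔m M N)))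
  in ℚ-≤-by (ℚ-+-nonneg (ℚ-+-nonneg x≥ y≤) (ℚ-0≤q-p (ℚ.<⇒≤ (ℚ.≰⇒> ¬h))))
    (solve 5 (λ x x′ y y′ d →
        x := (y :+ d) :+
          (((x :+ d) :- x′) :+ ((y′ :+ d) :- y) :+ (x′ :- (y′ :+ (d :+ d :+ d)))))
      refl (seq x n) (seq x K) (seq y n) (seq y K) d))
  where
  K : ℕ
  K = M ℕ.⊔ N

<⇒≱ : ∀ x y → y < x → ¬ (x ≤ y)
<⇒≱ x y (e , 0<e , h) x≤y with ℚ-halve e 0<e
... | d , 0<d , refl with eventually-∩ h (x≤y d 0<d)
...   | N , k with k N ℕ.≤-refl
...     | y+2d≤x , x≤y+d = ℚ.<-irrefl refl (ℚ.<-≤-trans 0<d (ℚ-≤-by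
  (ℚ-+-nonneg (ℚ-0≤q-p y+2d≤x) (ℚ-0≤q-p x≤y+d))
  (solve 3 (λ x y d → con 0ℚ := d :+ ((x :- (y :+ (d :+ d))) :+ ((y :+ d) :- x))) refl
    (seq x N) (seq y N) d)))

≰⇒≥ : ∀ x y → ¬ (x ≤ y) → y ≤ x
≰⇒≥ x y x≰y e 0<e =
  [ (λ h → h) , (λ x<y → ⊥-elim (x≰y (<⇒≤ x y x<y))) ]′ (≤+e-or-> y x e 0<e)

-- The order on ℝ is undecidable, but x ≤ y is ¬¬-stable, so an inequality
-- may be proved by comparing any two reals.
≤-by-cases : ∀ a b x y → (a ≤ b → x ≤ y) → (b ≤ a → x ≤ y) → x ≤ y
≤-by-cases a b x y case≤ case≥ e 0<e =
  [ (λ h → h) , (λ y<x → ⊥-elim (absurd y<x)) ]′ (≤+e-or-> x y e 0<e)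
  where
  absurd : ¬ (y < x)
  -- If `y < x`, then `case≤` refutes `a ≤ b`; this yields `b ≤ a`, and `case≥` gives the
  -- contradiction.
  absurd y<x = <⇒≱ x y y<x (case≥ (≰⇒≥ a b λ a≤b → <⇒≱ x y y<x (case≤ a≤b)))

0<1 : 0ℝ < 1ℝ
0<1 = 1ℚ , ℚ.positive⁻¹ 1ℚ , 0 , λ _ _ → ℚ.≤-refl

<-≤-trans : ∀ x y z → x < y → NonNeg (z - y) → x < z
<-≤-trans x y z (e , 0<e , h) (nonNeg 0≤z-y) with ℚ-halve e 0<e
... | d , 0<d , refl = d , 0<d , eventually-map step (eventually-∩ h (0≤z-y d 0<d))
  where
  step : ∀ n → seq x n ℚ.+ (d ℚ.+ d) ℚ.≤ seq y n × 0ℚ ℚ.≤ (seq z n ℚ.- seq y n) ℚ.+ d →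
         seq x n ℚ.+ d ℚ.≤ seq z n
  step n (k , l) = ℚ-≤-by (ℚ-+-nonneg (ℚ-0≤q-p k) l)
    (solve 4 (λ x y z d → z := (x :+ d) :+ ((y :- (x :+ (d :+ d))) :+ ((z :- y) :+ d))) refl
      (seq x n) (seq y n) (seq z n) d)

0≤1 : NonNeg 1ℝ
0≤1 = nonNeg λ e 0<e → 0 , λ _ _ → ℚ-+-nonneg (ℚ.<⇒≤ (ℚ.positive⁻¹ 1ℚ)) (ℚ.<⇒≤ 0<e)

fromℕ-suc : ∀ n → fromℕ (suc n) ≃ fromℕ n + 1ℝ
fromℕ-suc n = ≗⇒≃ (fromℕ (suc n)) (fromℕ n + 1ℝ) λ _ → trans
  -- Rational addition computes on the literal `mkℚ (+ n) 0 _`, which `↥p/↧p≡p` identifies with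
  -- `+ n / 1`.
  (cong (ℚ._/ 1) numerators)
  (cong (ℚ._+ 1ℚ) (sym (ℚ.↥p/↧p≡p (mkℚ (+ n) 0 (Coprimality.sym (Coprimality.1-coprimeTo n))))))
  where
  numerators : + suc n ≡ + n ℤ.* + 1 ℤ.+ + 1 ℤ.* + 1
  numerators = trans (cong +_ (ℕ.+-comm 1 n)) (cong (ℤ._+ + 1) (sym (ℤ.*-identityʳ (+ n))))

fromℕ-mono : ∀ {m n} → m ℕ.≤ n → NonNeg (fromℕ n - fromℕ m)
fromℕ-mono m≤n = go (ℕ.≤⇒≤′ m≤n)
  where
  go : ∀ {m n} → m ℕ.≤′ n → NonNeg (fromℕ n - fromℕ m)
  go {m} ℕ.≤′-refl = diff (fromℕ m) (fromℕ m) (≤-refl (fromℕ m))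
  go {m} {suc n} (ℕ.≤′-step m≤n) = diff (fromℕ m) (fromℕ (suc n)) (≤-by (fromℕ m) (fromℕ (suc n))
    (diff (fromℕ n + 1ℝ) (fromℕ (suc n)) (≃⇒≥ (fromℕ (suc n)) (fromℕ n + 1ℝ) (fromℕ-suc n))
      ⊕ go m≤n ⊕ 0≤1)
    λ k → solve 3 (λ m n n′ → n′ := m :+ ((n′ :- (n :+ con 1ℚ)) :+ (n :- m) :+ con 1ℚ)) refl
      (seq (fromℕ m) k) (seq (fromℕ n) k) (seq (fromℕ (suc n)) k))

fromℕ-nonNeg : ∀ n → NonNeg (fromℕ n)
fromℕ-nonNeg n = nonNeg (≤-by 0ℝ (fromℕ n) (fromℕ-mono {0} {n} ℕ.z≤n) λ k →
  solve 1 (λ n → n := con 0ℚ :+ (n :- con 0ℚ)) refl (seq (fromℕ n) k))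

-- Price bounds

-- Here `d` is any bound on the distance of `x` and `y`. This avoids absolute values, and
-- multiplying both prices by `1ℝ + r ≥ 0` just multiplies `d` by it. One side suffices, as the
-- hypotheses are symmetric in `x` and `y`.
LipschitzAbove : ℝ → (ℝ → ℝ) → Set
LipschitzAbove L f = ∀ x y d → x - y ≤ d → y - x ≤ d → f x ≤ f y + L * d

≤∣∣ : ∀ x → x ≤ ∣ x ∣
≤∣∣ x e 0<e = 0 , λ n _ → ℚ.≤-trans (p≤∣p∣ (seq x n)) (ℚ-≤-by (ℚ.<⇒≤ 0<e) refl)

∣x-y∣≤d : ∀ x y d → x - y ≤ d → y - x ≤ d → ∣ x - y ∣ ≤ d
∣x-y∣≤d x y d x-y≤d y-x≤d e 0<e = eventually-map step (eventually-∩ (x-y≤d e 0<e) (y-x≤d e 0<e))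
  where
  step : ∀ n → seq (x - y) n ℚ.≤ seq d n ℚ.+ e × seq (y - x) n ℚ.≤ seq d n ℚ.+ e →
         ℚ.∣ seq (x - y) n ∣ ℚ.≤ seq d n ℚ.+ e
  step n (h , k) with ℚ.∣p∣≡p∨∣p∣≡-p (seq (x - y) n)
  ... | inj₁ eq = subst (ℚ._≤ seq d n ℚ.+ e) (sym eq) h
  ... | inj₂ eq = subst (ℚ._≤ seq d n ℚ.+ e)
    (trans (solve 2 (λ x y → y :- x := :- (x :- y)) refl (seq x n) (seq y n)) (sym eq)) k

lipschitzAbove : ∀ {L g} → NonNeg L → (∀ x y → ∣ g x - g y ∣ ≤ L * ∣ x - y ∣) →
                 LipschitzAbove L g
lipschitzAbove {L} {g} 0≤L lip x y d x-y≤d y-x≤d = ≤-by (g x) (g y + L * d)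
  (diff (g x - g y) (∣ g x - g y ∣) (≤∣∣ (g x - g y))
    ⊕ diff (∣ g x - g y ∣) (L * ∣ x - y ∣) (lip x y)
    ⊕ 0≤L ⊛ diff (∣ x - y ∣) d (∣x-y∣≤d x y d x-y≤d y-x≤d))
  λ n → solve 6 (λ gx gy a L b d →
      gy :+ L :* d := gx :+ ((a :- (gx :- gy)) :+ (L :* b :- a) :+ L :* (d :- b))) refl
    (seq (g x) n) (seq (g y) n) (seq (∣ g x - g y ∣) n) (seq L n) (seq (∣ x - y ∣) n) (seq d n)

-- The extra index `k` counts the rounds left until `τ`; the error bound grows with it. The step
-- receives `t < τ` because `optimal` asks for it.
backward-induction : ∀ {τ} (P : ℕ → ℕ → Set) → P 0 τ →
  (∀ k t → k ℕ.+ suc t ≡ τ → t ℕ.< τ → P k (suc t) → P (suc k) t) → ∀ k t → k ℕ.+ t ≡ τ → P k t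
backward-induction P base step zero t refl = base
backward-induction P base step (suc k) t refl =
  step k t (ℕ.+-suc k t) (ℕ.s≤s (ℕ.m≤n+m t k))
    (backward-induction P base step k (suc t) (ℕ.+-suc k t))

Returns : Pred ℝ _ → Set
Returns U = ∀ r → r ∈ U → NonNeg (1ℝ + r)

module _ {τ : ℕ} {g : ℝ → ℝ} {U W : Pred ℝ _} {V : ℕ → ℝ → ℕ → ℝ}
         (V-bound : IsPriceBound τ g U W V) (U-returns : Returns U) (W-returns : Returns W) where

  open IsPriceBound V-bound

  price-lipschitz : ∀ {L} → NonNeg L → LipschitzAbove L g →
    ∀ k t → k ℕ.+ t ≡ τ → ∀ m → LipschitzAbove L (λ x → V t x m)
  price-lipschitz {L} 0≤L g-lip = backward-induction
    (λ _ t → ∀ m → LipschitzAbove L (λ x → V t x m))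
    (λ m x y d x-y≤d y-x≤d → ≤-by (V τ x m) (V τ y m + L * d)
      (diff (V τ x m) (g x) (≃⇒≤ (V τ x m) (g x) (terminal x m))
        ⊕ diff (g x) (g y + L * d) (g-lip x y d x-y≤d y-x≤d)
        ⊕ diff (g y) (V τ y m) (≃⇒≥ (V τ y m) (g y) (terminal y m)))
      λ n → solve 6 (λ vx vy gx gy L d →
          vy :+ L :* d := vx :+ ((gx :- vx) :+ (gy :+ L :* d :- gx) :+ (vy :- gy))) refl
        (seq (V τ x m) n) (seq (V τ y m) n) (seq (g x) n) (seq (g y) n) (seq L n) (seq d n))
    step
    where
    step : ∀ k t → k ℕ.+ suc t ≡ τ → t ℕ.< τ → (∀ m → LipschitzAbove L (λ x → V (suc t) x m)) →
           ∀ m → LipschitzAbove L (λ x → V t x m)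
    step _ t _ t<τ ih m x y d x-y≤d y-x≤d = ≤-by (V t x m) (V t y m + L * d)
      -- The infimum at `y` is not known to be attained, so `V t x m - L * d` is shown to lie below
      -- every feasible `p` at `y`. The later comparisons of price bounds follow the same pattern.
      (diff (V t x m - L * d) (V t y m) (proj₂ (optimal t t<τ y m) (V t x m - L * d) λ where
        p (Δ , onU , onW) → ≤-by (V t x m - L * d) p
          (diff (V t x m) (p + L * d) (proj₁ (optimal t t<τ x m) (p + L * d)
            (Δ + L * d ,
             (λ r r∈U → constraint p Δ m r (U-returns r r∈U) (onU r r∈U)) ,
             (λ 1≤m r r∈W → constraint p Δ (m ℕ.∸ 1) r (W-returns r r∈W) (onW 1≤m r r∈W)))))
          λ n → solve 4 (λ v L d p → p := (v :- L :* d) :+ ((p :+ L :* d) :- v)) refl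
            (seq (V t x m) n) (seq L n) (seq d n) (seq p n)))
      λ n → solve 4 (λ v w L d → w :+ L :* d := v :+ (w :- (v :- L :* d))) refl
        (seq (V t x m) n) (seq (V t y m) n) (seq L n) (seq d n)
      where
      scale : ∀ a b r → NonNeg (1ℝ + r) → a - b ≤ d → a * (1ℝ + r) - b * (1ℝ + r) ≤ d * (1ℝ + r)
      scale a b r 0≤1+r a-b≤d = ≤-by (a * (1ℝ + r) - b * (1ℝ + r)) (d * (1ℝ + r))
        (0≤1+r ⊛ diff (a - b) d a-b≤d)
        λ n → solve 4 (λ a b d r → d :* (con 1ℚ :+ r) :=
            (a :* (con 1ℚ :+ r) :- b :* (con 1ℚ :+ r)) :+ (con 1ℚ :+ r) :* (d :- (a :- b))) refl
          (seq a n) (seq b n) (seq d n) (seq r n)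
      -- The next prices differ by at most `d * (1ℝ + r)`, which costs `L * d + r * (L * d)`: the
      -- first term is paid by the shift of `p`, the second by the shift of `Δ`.
      constraint : ∀ p Δ m r → NonNeg (1ℝ + r) → V (suc t) (y * (1ℝ + r)) m - r * Δ ≤ p →
        V (suc t) (x * (1ℝ + r)) m - r * (Δ + L * d) ≤ p + L * d
      constraint p Δ m r 0≤1+r h = ≤-by (v - r * (Δ + L * d)) (p + L * d)
        (diff v (w + L * (d * (1ℝ + r)))
            (ih m (x * (1ℝ + r)) (y * (1ℝ + r)) (d * (1ℝ + r))
              (scale x y r 0≤1+r x-y≤d) (scale y x r 0≤1+r y-x≤d))
          ⊕ diff (w - r * Δ) p h)
        λ n → solve 7 (λ v w L d r p Δ → p :+ L :* d := (v :- r :* (Δ :+ L :* d)) :+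
            ((w :+ L :* (d :* (con 1ℚ :+ r)) :- v) :+ (p :- (w :- r :* Δ)))) refl
          (seq v n) (seq w n) (seq L n) (seq d n) (seq r n) (seq p n) (seq Δ n)
        where
        v w : ℝ
        v = V (suc t) (x * (1ℝ + r)) m
        w = V (suc t) (y * (1ℝ + r)) m

  -- The pair with `p` and `Δ` both equal to `L * x` is feasible, since
  -- `L * (x * (1 + r)) - r * (L * x) = L * x` whatever the return `r`.
  price-≤-linear : ∀ {L} → (∀ x → NonNeg x → g x ≤ L * x) →
    ∀ k t → k ℕ.+ t ≡ τ → ∀ m x → NonNeg x → V t x m ≤ L * x
  price-≤-linear {L} g≤ = backward-induction (λ _ t → ∀ m x → NonNeg x → V t x m ≤ L * x)
    (λ m x 0≤x → ≤-trans (V τ x m) (g x) (L * x) (≃⇒≤ (V τ x m) (g x) (terminal x m)) (g≤ x 0≤x))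
    step
    where
    step : ∀ k t → k ℕ.+ suc t ≡ τ → t ℕ.< τ → (∀ m x → NonNeg x → V (suc t) x m ≤ L * x) →
           ∀ m x → NonNeg x → V t x m ≤ L * x
    step _ t _ t<τ ih m x 0≤x = proj₁ (optimal t t<τ x m) (L * x)
      (L * x ,
       (λ r r∈U → constraint m r (U-returns r r∈U)) ,
       (λ _ r r∈W → constraint (m ℕ.∸ 1) r (W-returns r r∈W)))
      where
      constraint : ∀ m r → NonNeg (1ℝ + r) → V (suc t) (x * (1ℝ + r)) m - r * (L * x) ≤ L * x
      constraint m r 0≤1+r = ≤-by (v - r * (L * x)) (L * x)
        (diff v (L * (x * (1ℝ + r))) (ih m (x * (1ℝ + r)) (0≤x ⊛ 0≤1+r)))
        λ n → solve 4 (λ v L x r → L :* x :=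
            (v :- r :* (L :* x)) :+ (L :* (x :* (con 1ℚ :+ r)) :- v)) refl
          (seq v n) (seq L n) (seq x n) (seq r n)
        where
        v : ℝ
        v = V (suc t) (x * (1ℝ + r)) m

  -- Whatever the sign of `Δ`, one of `r₋` and `r₊` makes `r * Δ ≤ 0`, and its constraint bounds `p`
  -- below by a nonnegative later price. Only two members of `U` are involved, so grids qualify too.
  price-nonNeg : (∀ x → NonNeg x → NonNeg (g x)) →
    ∀ r₋ r₊ → r₋ ∈ U → r₋ ≤ 0ℝ → r₊ ∈ U → 0ℝ ≤ r₊ →
    ∀ k t → k ℕ.+ t ≡ τ → ∀ m x → NonNeg x → NonNeg (V t x m)
  price-nonNeg g-nonNeg r₋ r₊ r₋∈U r₋≤0 r₊∈U 0≤r₊ =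
    backward-induction (λ _ t → ∀ m x → NonNeg x → NonNeg (V t x m))
      (λ m x 0≤x → nonNeg (≤-trans 0ℝ (g x) (V τ x m) (0≤ (g-nonNeg x 0≤x))
        (≃⇒≥ (V τ x m) (g x) (terminal x m))))
      step
    where
    step : ∀ k t → k ℕ.+ suc t ≡ τ → t ℕ.< τ → (∀ m x → NonNeg x → NonNeg (V (suc t) x m)) →
           ∀ m x → NonNeg x → NonNeg (V t x m)
    step _ t _ t<τ ih m x 0≤x = nonNeg (proj₂ (optimal t t<τ x m) 0ℝ λ where
      p (Δ , onU , _) → ≤-by-cases 0ℝ Δ 0ℝ p
        (λ 0≤Δ → let v = V (suc t) (x * (1ℝ + r₋)) m in
          ≤-by 0ℝ p
            (diff (v - r₋ * Δ) p (onU r₋ r₋∈U)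
              ⊕ ih m (x * (1ℝ + r₋)) (0≤x ⊛ U-returns r₋ r₋∈U)
              ⊕ diff r₋ 0ℝ r₋≤0 ⊛ diff 0ℝ Δ 0≤Δ)
            λ n → solve 4 (λ p v r Δ → p := con 0ℚ :+
                ((p :- (v :- r :* Δ)) :+ v :+ (con 0ℚ :- r) :* (Δ :- con 0ℚ))) refl
              (seq p n) (seq v n) (seq r₋ n) (seq Δ n))
        (λ Δ≤0 → let v = V (suc t) (x * (1ℝ + r₊)) m in
          ≤-by 0ℝ p
            (diff (v - r₊ * Δ) p (onU r₊ r₊∈U)
              ⊕ ih m (x * (1ℝ + r₊)) (0≤x ⊛ U-returns r₊ r₊∈U)
              ⊕ diff 0ℝ r₊ 0≤r₊ ⊛ diff Δ 0ℝ Δ≤0)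
            λ n → solve 4 (λ p v r Δ → p := con 0ℚ :+
                ((p :- (v :- r :* Δ)) :+ v :+ (r :- con 0ℚ) :* (con 0ℚ :- Δ))) refl
              (seq p n) (seq v n) (seq r₊ n) (seq Δ n)))

-- Each pair `(p , Δ)` feasible for `V′` is feasible for `V`: the constraints of `V` are among those
-- of `V′`, and by induction their left-hand sides are no larger.
price-mono-⊆ : ∀ {τ g U W U′ W′ V V′} → U ⊆ U′ → W ⊆ W′ →
  IsPriceBound τ g U W V → IsPriceBound τ g U′ W′ V′ →
  ∀ k t → k ℕ.+ t ≡ τ → ∀ m x → V t x m ≤ V′ t x m
price-mono-⊆ {τ} {g} {V = V} {V′} U⊆U′ W⊆W′ V-bound V′-bound =
  backward-induction (λ _ t → ∀ m x → V t x m ≤ V′ t x m)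
    (λ m x → ≤-trans (V τ x m) (g x) (V′ τ x m)
      (≃⇒≤ (V τ x m) (g x) (V.terminal x m)) (≃⇒≥ (V′ τ x m) (g x) (V′.terminal x m)))
    (λ _ t _ t<τ ih m x → proj₂ (V′.optimal t t<τ x m) (V t x m) λ where
      p (Δ , onU , onW) → proj₁ (V.optimal t t<τ x m) p
        (Δ ,
         (λ r r∈U → constraint p Δ t ih m x r (onU r (U⊆U′ r∈U))) ,
         (λ 1≤m r r∈W → constraint p Δ t ih (m ℕ.∸ 1) x r (onW 1≤m r (W⊆W′ r∈W)))))
  where
  module V = IsPriceBound V-bound
  module V′ = IsPriceBound V′-bound
  constraint : ∀ p Δ t → (∀ m x → V (suc t) x m ≤ V′ (suc t) x m) → ∀ m x r →
    V′ (suc t) (x * (1ℝ + r)) m - r * Δ ≤ p → V (suc t) (x * (1ℝ + r)) m - r * Δ ≤ p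
  constraint p Δ t ih m x r h = ≤-by (v - r * Δ) p
    (diff v v′ (ih m (x * (1ℝ + r))) ⊕ diff (v′ - r * Δ) p h)
    λ n → solve 5 (λ v v′ r Δ p → p := (v :- r :* Δ) :+ ((v′ :- v) :+ (p :- (v′ :- r :* Δ)))) refl
      (seq v n) (seq v′ n) (seq r n) (seq Δ n) (seq p n)
    where
    v v′ : ℝ
    v = V (suc t) (x * (1ℝ + r)) m
    v′ = V′ (suc t) (x * (1ℝ + r)) m

-- Grids and the passage from grid points to intervals

left∈Grid : ∀ ε a b → a ≤ b → a ∈ Grid ε a b
left∈Grid ε a b a≤b = (≤-refl a , a≤b) , 0 , ≗⇒≃ a (a + fromℕ 0 * ε) λ n →
  solve 2 (λ a ε → a := a :+ con 0ℚ :* ε) refl (seq a n) (seq ε n)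

right∈Grid : ∀ ε a b → a ≤ b → IsMultipleOf ε (b - a) → b ∈ Grid ε a b
right∈Grid ε a b a≤b (k , b-a≃kε) = (a≤b , ≤-refl b) , k , λ e 0<e →
  eventually-map (λ n → subst (λ q → ℚ.∣ q ∣ ℚ.≤ e)
    (solve 4 (λ a b k ε → (b :- a) :- k :* ε := b :- (a :+ k :* ε)) refl
      (seq a n) (seq b n) (seq (fromℕ k) n) (seq ε n)))
    (b-a≃kε e 0<e)

-- A point r lies between two neighbouring grid points; the left one is used
-- for Δ ≥ 0 and the right one for Δ ≤ 0, so that the term r Δ costs nothing.
grid⇒interval : ∀ ε a b e p Δ (f : ℝ → ℝ) → NonNeg ε → IsMultipleOf ε (b - a) →
  (∀ r s → r - s ≤ ε → s - r ≤ ε → f r ≤ f s + e) →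
  (∀ s → s ∈ Grid ε a b → f s - s * Δ ≤ p) →
  ∀ r → r ∈ Interval a b → f r - r * Δ ≤ p + e
grid⇒interval ε a b e p Δ f 0≤ε (k , b-a≃kε) f-close onGrid r (a≤r , r≤b) =
  -- The length being a multiple of `ε`, the node of index `k` equals `b`, so `r` lies below it and
  -- the search starts there.
  climb k ℕ.≤-refl (≤-by r (node k)
    (diff r b r≤b ⊕ diff (b - a) (fromℕ k * ε) (≃⇒≤ (b - a) (fromℕ k * ε) b-a≃kε))
    λ n → solve 5 (λ r a b k ε → a :+ k :* ε := r :+ ((b :- r) :+ (k :* ε :- (b :- a)))) refl
      (seq r n) (seq a n) (seq b n) (seq (fromℕ k) n) (seq ε n))
  where
  node : ℕ → ℝ
  node i = a + fromℕ i * ε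

  node∈Grid : ∀ {i} → i ℕ.≤ k → node i ∈ Grid ε a b
  node∈Grid {i} i≤k =
    ( ≤-by a (node i) (fromℕ-nonNeg i ⊛ 0≤ε) (λ _ → refl)
    , ≤-by (node i) b
        (fromℕ-mono i≤k ⊛ 0≤ε ⊕ diff (fromℕ k * ε) (b - a) (≃⇒≥ (b - a) (fromℕ k * ε) b-a≃kε))
        λ n → solve 5 (λ a b i k ε →
            b := (a :+ i :* ε) :+ ((k :- i) :* ε :+ ((b :- a) :- k :* ε))) refl
          (seq a n) (seq b n) (seq (fromℕ i) n) (seq (fromℕ k) n) (seq ε n))
    , i , ≗⇒≃ (node i) (node i) λ _ → refl

  between : ∀ s₁ s₂ → s₁ ∈ Grid ε a b → s₂ ∈ Grid ε a b → s₁ ≤ r → r ≤ s₂ → s₂ - s₁ ≤ ε →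
            f r - r * Δ ≤ p + e
  between s₁ s₂ s₁∈ s₂∈ s₁≤r r≤s₂ s₂-s₁≤ε = ≤-by-cases 0ℝ Δ (f r - r * Δ) (p + e)
    (λ 0≤Δ → ≤-by (f r - r * Δ) (p + e)
      (diff (f r) (f s₁ + e) (f-close r s₁ r-s₁≤ε s₁-r≤ε)
        ⊕ diff (f s₁ - s₁ * Δ) p (onGrid s₁ s₁∈)
        ⊕ diff s₁ r s₁≤r ⊛ diff 0ℝ Δ 0≤Δ)
      λ n → solve 7 (λ fr fs r s Δ p e → p :+ e := (fr :- r :* Δ) :+
          ((fs :+ e :- fr) :+ (p :- (fs :- s :* Δ)) :+ (r :- s) :* (Δ :- con 0ℚ))) refl
        (seq (f r) n) (seq (f s₁) n) (seq r n) (seq s₁ n) (seq Δ n) (seq p n) (seq e n))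
    (λ Δ≤0 → ≤-by (f r - r * Δ) (p + e)
      (diff (f r) (f s₂ + e) (f-close r s₂ r-s₂≤ε s₂-r≤ε)
        ⊕ diff (f s₂ - s₂ * Δ) p (onGrid s₂ s₂∈)
        ⊕ diff r s₂ r≤s₂ ⊛ diff Δ 0ℝ Δ≤0)
      λ n → solve 7 (λ fr fs r s Δ p e → p :+ e := (fr :- r :* Δ) :+
          ((fs :+ e :- fr) :+ (p :- (fs :- s :* Δ)) :+ (s :- r) :* (con 0ℚ :- Δ))) refl
        (seq (f r) n) (seq (f s₂) n) (seq r n) (seq s₂ n) (seq Δ n) (seq p n) (seq e n))
    where
    r-s₁≤ε : r - s₁ ≤ ε
    r-s₁≤ε = ≤-by (r - s₁) ε (diff r s₂ r≤s₂ ⊕ diff (s₂ - s₁) ε s₂-s₁≤ε) λ n →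
      solve 4 (λ r s₁ s₂ ε → ε := (r :- s₁) :+ ((s₂ :- r) :+ (ε :- (s₂ :- s₁)))) refl
        (seq r n) (seq s₁ n) (seq s₂ n) (seq ε n)
    s₂-r≤ε : s₂ - r ≤ ε
    s₂-r≤ε = ≤-by (s₂ - r) ε (diff s₁ r s₁≤r ⊕ diff (s₂ - s₁) ε s₂-s₁≤ε) λ n →
      solve 4 (λ r s₁ s₂ ε → ε := (s₂ :- r) :+ ((r :- s₁) :+ (ε :- (s₂ :- s₁)))) refl
        (seq r n) (seq s₁ n) (seq s₂ n) (seq ε n)
    s₁-r≤ε : s₁ - r ≤ ε
    s₁-r≤ε = ≤-by (s₁ - r) ε (diff s₁ r s₁≤r ⊕ 0≤ε) λ n →
      solve 3 (λ r s ε → ε := (s :- r) :+ ((r :- s) :+ ε)) refl (seq r n) (seq s₁ n) (seq ε n)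
    r-s₂≤ε : r - s₂ ≤ ε
    r-s₂≤ε = ≤-by (r - s₂) ε (diff r s₂ r≤s₂ ⊕ 0≤ε) λ n →
      solve 3 (λ r s ε → ε := (r :- s) :+ ((s :- r) :+ ε)) refl (seq r n) (seq s₂ n) (seq ε n)

  -- The search runs downwards: either `r` is below the preceding node, or the two nodes enclose it.
  -- `≤-by-cases` permits this undecidable comparison because the goal is an inequality. At index 0
  -- the left endpoint serves as both neighbours.
  climb : ∀ j → j ℕ.≤ k → r ≤ node j → f r - r * Δ ≤ p + e
  climb zero _ r≤node = between (node 0) (node 0) (node∈Grid ℕ.z≤n) (node∈Grid ℕ.z≤n)
    (≤-by (node 0) r (diff a r a≤r) λ n →
      solve 3 (λ a ε r → r := (a :+ con 0ℚ :* ε) :+ (r :- a)) refl (seq a n) (seq ε n) (seq r n))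
    r≤node
    (≤-by (node 0 - node 0) ε 0≤ε λ n →
      solve 2 (λ s ε → ε := (s :- s) :+ ε) refl (seq (node 0) n) (seq ε n))
  climb (suc j) j<k r≤node = ≤-by-cases r (node j) (f r - r * Δ) (p + e)
    (climb j (ℕ.<⇒≤ j<k))
    (λ node≤r → between (node j) (node (suc j)) (node∈Grid (ℕ.<⇒≤ j<k)) (node∈Grid j<k)
      node≤r r≤node
      (≤-by (node (suc j) - node j) ε
        (diff (fromℕ (suc j)) (fromℕ j + 1ℝ)
            (≃⇒≤ (fromℕ (suc j)) (fromℕ j + 1ℝ) (fromℕ-suc j)) ⊛ 0≤ε)
        λ n → solve 4 (λ a j j′ ε → ε :=
            ((a :+ j′ :* ε) :- (a :+ j :* ε)) :+ ((j :+ con 1ℚ) :- j′) :* ε) refl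
          (seq a n) (seq (fromℕ j) n) (seq (fromℕ (suc j)) n) (seq ε n)))

-- Accumulation of the discretisation error over the rounds

module _ (a b c d ε L : ℝ) {τ : ℕ} {g : ℝ → ℝ} {G Ĝ : ℕ → ℝ → ℕ → ℝ}
         (G-bound : IsPriceBound τ g (Interval a b) (Interval c d) G)
         (Ĝ-bound : IsPriceBound τ g (Grid ε a b) (Grid ε c d) Ĝ)
         (U-returns : Returns (Interval a b)) (W-returns : Returns (Interval c d))
         (0≤ε : NonNeg ε) (0≤L : NonNeg L) (g-lip : LipschitzAbove L g)
         (U-multiple : IsMultipleOf ε (b - a)) (W-multiple : IsMultipleOf ε (d - c)) where

  private
    module G = IsPriceBound G-bound
    module Ĝ = IsPriceBound Ĝ-bound

    -- The error is linear in the price. At the next price `x * (1ℝ + s)` it is therefore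
    -- `k * e + s * (k * e)` with `e = L * (ε * x)`, which shifting both `p` and `Δ` by `k * e` pays
    -- for exactly.
    ErrorBound : ℕ → ℕ → Set
    ErrorBound k t = ∀ m x → NonNeg x → G t x m ≤ Ĝ t x m + fromℕ k * (L * (ε * x))

  discretisation-error : ∀ k t → k ℕ.+ t ≡ τ → ErrorBound k t
  discretisation-error = backward-induction ErrorBound base step
    where
    base : ErrorBound 0 τ
    base m x 0≤x = ≤-by (G τ x m) (Ĝ τ x m + fromℕ 0 * (L * (ε * x)))
      (diff (G τ x m) (g x) (≃⇒≤ (G τ x m) (g x) (G.terminal x m))
        ⊕ diff (g x) (Ĝ τ x m) (≃⇒≥ (Ĝ τ x m) (g x) (Ĝ.terminal x m)))
      λ n → solve 6 (λ v v̂ g L ε x →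
          v̂ :+ con 0ℚ :* (L :* (ε :* x)) := v :+ ((g :- v) :+ (v̂ :- g))) refl
        (seq (G τ x m) n) (seq (Ĝ τ x m) n) (seq (g x) n) (seq L n) (seq ε n) (seq x n)

    step : ∀ k t → k ℕ.+ suc t ≡ τ → t ℕ.< τ → ErrorBound k (suc t) → ErrorBound (suc k) t
    step k t k+1+t≡τ t<τ ih m x 0≤x = ≤-by (G t x m) (Ĝ t x m + fromℕ (suc k) * e)
      (diff (G t x m - (fromℕ k * e + e)) (Ĝ t x m)
          (proj₂ (Ĝ.optimal t t<τ x m) (G t x m - (fromℕ k * e + e)) λ where
        p (Δ , onU , onW) → ≤-by (G t x m - (fromℕ k * e + e)) p
          (diff (G t x m) (p + fromℕ k * e + e) (proj₁ (G.optimal t t<τ x m) (p + fromℕ k * e + e)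
            -- The amount `k * e` in both coordinates covers the error of the later rounds; the
            -- additional `e` in `p` covers the rounding of `r` to a grid point in this round.
            (Δ + fromℕ k * e ,
             interval-constraint a b p Δ m U-returns U-multiple onU ,
             (λ 1≤m → interval-constraint c d p Δ (m ℕ.∸ 1) W-returns W-multiple (onW 1≤m)))))
          λ n → solve 4 (λ v k e p → p := (v :- (k :* e :+ e)) :+ ((p :+ k :* e :+ e) :- v)) refl
            (seq (G t x m) n) (seq (fromℕ k) n) (seq e n) (seq p n))
        ⊕ diff (fromℕ k + 1ℝ) (fromℕ (suc k))
            (≃⇒≥ (fromℕ (suc k)) (fromℕ k + 1ℝ) (fromℕ-suc k)) ⊛ 0≤e)
      λ n → solve 5 (λ v v̂ k k′ e → v̂ :+ k′ :* e :=
          v :+ ((v̂ :- (v :- (k :* e :+ e))) :+ (k′ :- (k :+ con 1ℚ)) :* e)) refl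
        (seq (G t x m) n) (seq (Ĝ t x m) n) (seq (fromℕ k) n) (seq (fromℕ (suc k)) n) (seq e n)
      where
      e : ℝ
      e = L * (ε * x)

      0≤e : NonNeg e
      0≤e = 0≤L ⊛ (0≤ε ⊛ 0≤x)

      scale : ∀ r s → r - s ≤ ε → x * (1ℝ + r) - x * (1ℝ + s) ≤ ε * x
      scale r s r-s≤ε = ≤-by (x * (1ℝ + r) - x * (1ℝ + s)) (ε * x)
        (0≤x ⊛ diff (r - s) ε r-s≤ε) λ n →
        solve 4 (λ x r s ε → ε :* x :=
            (x :* (con 1ℚ :+ r) :- x :* (con 1ℚ :+ s)) :+ x :* (ε :- (r :- s))) refl
          (seq x n) (seq r n) (seq s n) (seq ε n)

      close : ∀ m r s → r - s ≤ ε → s - r ≤ ε →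
              G (suc t) (x * (1ℝ + r)) m ≤ G (suc t) (x * (1ℝ + s)) m + e
      close m r s r-s≤ε s-r≤ε = price-lipschitz
        G-bound U-returns W-returns {L} 0≤L g-lip k (suc t) k+1+t≡τ m
        (x * (1ℝ + r)) (x * (1ℝ + s)) (ε * x) (scale r s r-s≤ε) (scale s r s-r≤ε)

      constraint : ∀ p Δ m s → NonNeg (1ℝ + s) → Ĝ (suc t) (x * (1ℝ + s)) m - s * Δ ≤ p →
        G (suc t) (x * (1ℝ + s)) m - s * (Δ + fromℕ k * e) ≤ p + fromℕ k * e
      constraint p Δ m s 0≤1+s h = ≤-by (v - s * (Δ + fromℕ k * e)) (p + fromℕ k * e)
        (diff v (v̂ + fromℕ k * (L * (ε * (x * (1ℝ + s))))) (ih m (x * (1ℝ + s)) (0≤x ⊛ 0≤1+s))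
          ⊕ diff (v̂ - s * Δ) p h)
        λ n → solve 9 (λ v v̂ k L ε x s p Δ → p :+ k :* (L :* (ε :* x)) :=
            (v :- s :* (Δ :+ k :* (L :* (ε :* x)))) :+
            ((v̂ :+ k :* (L :* (ε :* (x :* (con 1ℚ :+ s)))) :- v) :+ (p :- (v̂ :- s :* Δ)))) refl
          (seq v n) (seq v̂ n) (seq (fromℕ k) n) (seq L n) (seq ε n)
          (seq x n) (seq s n) (seq p n) (seq Δ n)
        where
        v v̂ : ℝ
        v = G (suc t) (x * (1ℝ + s)) m
        v̂ = Ĝ (suc t) (x * (1ℝ + s)) m

      interval-constraint : ∀ a b p Δ m → Returns (Interval a b) → IsMultipleOf ε (b - a) →
        (∀ s → s ∈ Grid ε a b → Ĝ (suc t) (x * (1ℝ + s)) m - s * Δ ≤ p) →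
        ∀ r → r ∈ Interval a b →
        G (suc t) (x * (1ℝ + r)) m - r * (Δ + fromℕ k * e) ≤ p + fromℕ k * e + e
      interval-constraint a b p Δ m returns multiple onGrid =
        -- First `Ĝ` is replaced by `G` at grid points, by induction; then the Lipschitz bound for
        -- `G` extends the constraint to the whole interval.
        grid⇒interval ε a b e (p + fromℕ k * e) (Δ + fromℕ k * e)
          (λ r → G (suc t) (x * (1ℝ + r)) m) 0≤ε multiple (close m)
          (λ s s∈ → constraint p Δ m s (returns s (proj₁ s∈)) (onGrid s s∈))

-- The price inequalities, by comparing `δ` with `L * τ`

corollaryG2 :
  ∃[ c ] (0ℝ < c ×
    (∀ (δ : ℝ) → 0ℝ < δ →
     ∀ (τ ℓ : ℕ) → 1 ℕ.≤ τ →
     ∀ (S₀ L : ℝ) → 0ℝ < S₀ → 0ℝ < L →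
     -- 𝒰 = [- ζ₋ , ζ₊]
     ∀ (ζ₋ ζ₊ : ℝ) → 0ℝ < ζ₋ → ζ₋ ≤ 1ℝ → 0ℝ < ζ₊ →
     -- 𝒲 = [w₋ , w₊]
     ∀ (w₋ w₊ : ℝ) → - 1ℝ ≤ w₋ → w₋ < w₊ →
     ∀ (g : ℝ → ℝ) → (∀ x y → x ≤ y → g x ≤ g y) → g 0ℝ ≃ 0ℝ →
     (∀ x y → ∣ g x - g y ∣ ≤ L * ∣ x - y ∣) →
     -- ε = c δ² / (L² τ²)
     ∀ (ε : ℝ) → ε * ((L * L) * (fromℕ τ * fromℕ τ)) ≃ c * (δ * δ) →
     IsMultipleOf ε (ζ₊ - (- ζ₋)) → IsMultipleOf ε (w₊ - w₋) →
     ∀ (G Ĝ : ℕ → ℝ → ℕ → ℝ) →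
     IsPriceBound τ g (Interval (- ζ₋) ζ₊) (Interval w₋ w₊) G →
     IsPriceBound τ g (Grid ε (- ζ₋) ζ₊) (Grid ε w₋ w₊) Ĝ →
     (G 0 S₀ ℓ - δ * S₀ ≤ Ĝ 0 S₀ ℓ) × (Ĝ 0 S₀ ℓ ≤ G 0 S₀ ℓ)))
corollaryG2 = 1ℝ , 0<1 , λ δ 0<δ τ ℓ 1≤τ S₀ L 0<S₀ 0<L ζ₋ ζ₊ 0<ζ₋ ζ₋≤1 0<ζ₊ w₋ w₊ -1≤w₋ _
    g g-mono g0≃0 g-lip ε ε-def U-multiple W-multiple G Ĝ G-bound Ĝ-bound →
  let
    0≤δ : NonNeg δ
    0≤δ = nonNeg (<⇒≤ 0ℝ δ 0<δ)
    0≤S₀ : NonNeg S₀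
    0≤S₀ = nonNeg (<⇒≤ 0ℝ S₀ 0<S₀)
    0≤L : NonNeg L
    0≤L = nonNeg (<⇒≤ 0ℝ L 0<L)
    τ-1≥0 : NonNeg (fromℕ τ - 1ℝ)
    τ-1≥0 = fromℕ-mono 1≤τ
    T = fromℕ τ

    cancel : ∀ y z → L * (T * y) ≤ L * (T * z) → y ≤ z
    cancel y z h = *-cancelˡ-≤ T y z (<-≤-trans 0ℝ 1ℝ T 0<1 τ-1≥0)
      (*-cancelˡ-≤ L (T * y) (T * z) 0<L h)

    -- The sign of `ε` is read off its defining equation: `L * T` is cancelled twice from
    -- `0 ≤ (L * T) * (L * T) * ε`, whose right-hand side is `δ * δ`.
    0≤ε : NonNeg ε
    0≤ε = nonNeg (cancel 0ℝ ε (cancel (L * (T * 0ℝ)) (L * (T * ε))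
      (≤-by (L * (T * (L * (T * 0ℝ)))) (L * (T * (L * (T * ε))))
        (diff (1ℝ * (δ * δ)) (ε * ((L * L) * (T * T)))
            (≃⇒≥ (ε * ((L * L) * (T * T))) (1ℝ * (δ * δ)) ε-def)
          ⊕ 0≤δ ⊛ 0≤δ)
        λ n → solve 4 (λ L T ε δ → L :* (T :* (L :* (T :* ε))) :=
            L :* (T :* (L :* (T :* con 0ℚ))) :+
            ((ε :* ((L :* L) :* (T :* T)) :- con 1ℚ :* (δ :* δ)) :+ δ :* δ)) refl
          (seq L n) (seq T n) (seq ε n) (seq δ n))))

    U-returns : Returns (Interval (- ζ₋) ζ₊)
    U-returns r (-ζ₋≤r , _) = nonNeg (≤-by 0ℝ (1ℝ + r) (diff ζ₋ 1ℝ ζ₋≤1 ⊕ diff (- ζ₋) r -ζ₋≤r) λ n →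
      solve 2 (λ r ζ → con 1ℚ :+ r := con 0ℚ :+ ((con 1ℚ :- ζ) :+ (r :- (:- ζ)))) refl
        (seq r n) (seq ζ₋ n))
    W-returns : Returns (Interval w₋ w₊)
    W-returns r (w₋≤r , _) = nonNeg (≤-by 0ℝ (1ℝ + r) (diff (- 1ℝ) w₋ -1≤w₋ ⊕ diff w₋ r w₋≤r) λ n →
      solve 2 (λ r w → con 1ℚ :+ r := con 0ℚ :+ ((w :- (:- con 1ℚ)) :+ (r :- w))) refl
        (seq r n) (seq w₋ n))

    0≤ζ₋ : NonNeg ζ₋
    0≤ζ₋ = nonNeg (<⇒≤ 0ℝ ζ₋ 0<ζ₋)

    -ζ₋≤0 : - ζ₋ ≤ 0ℝ
    -ζ₋≤0 = ≤-by (- ζ₋) 0ℝ 0≤ζ₋ λ n →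
      solve 1 (λ ζ → con 0ℚ := :- ζ :+ ζ) refl (seq ζ₋ n)
    -ζ₋≤ζ₊ = ≤-trans (- ζ₋) 0ℝ ζ₊ -ζ₋≤0 (<⇒≤ 0ℝ ζ₊ 0<ζ₊)

    g-lip⁺ : LipschitzAbove L g
    g-lip⁺ = lipschitzAbove {L} {g} 0≤L g-lip

    g≤ : ∀ x → NonNeg x → g x ≤ L * x
    g≤ x 0≤x = ≤-by (g x) (L * x)
      (diff (g x) (g 0ℝ + L * x) (g-lip⁺ x 0ℝ x
          (≤-by (x - 0ℝ) x (diff 0ℝ 0ℝ (≤-refl 0ℝ)) λ n →
            solve 1 (λ x → x := (x :- con 0ℚ) :+ (con 0ℚ :- con 0ℚ)) refl (seq x n))
          (≤-by (0ℝ - x) x (0≤x ⊕ 0≤x) λ n →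
            solve 1 (λ x → x := (con 0ℚ :- x) :+ (x :+ x)) refl (seq x n)))
        ⊕ diff (g 0ℝ) 0ℝ (≃⇒≤ (g 0ℝ) 0ℝ g0≃0))
      λ n → solve 4 (λ gx g0 L x → L :* x := gx :+ ((g0 :+ L :* x :- gx) :+ (con 0ℚ :- g0))) refl
        (seq (g x) n) (seq (g 0ℝ) n) (seq L n) (seq x n)

    g≥0 : ∀ x → NonNeg x → NonNeg (g x)
    g≥0 x 0≤x = nonNeg (≤-trans 0ℝ (g 0ℝ) (g x) (≃⇒≥ (g 0ℝ) 0ℝ g0≃0) (g-mono 0ℝ x (0≤ 0≤x)))

    v = G 0 S₀ ℓ
    v̂ = Ĝ 0 S₀ ℓ

    small : δ ≤ L * T → v - δ * S₀ ≤ v̂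
    small δ≤LT = ≤-by (v - δ * S₀) v̂
      (diff v (v̂ + T * (L * (ε * S₀))) (discretisation-error (- ζ₋) ζ₊ w₋ w₊ ε L
          G-bound Ĝ-bound U-returns W-returns 0≤ε 0≤L g-lip⁺
          U-multiple W-multiple τ 0 (ℕ.+-identityʳ τ) ℓ S₀ 0≤S₀)
        -- Multiplied by `L * T`, the claim `T * (L * ε) ≤ δ` becomes `δ * δ ≤ (L * T) * δ`, which
        -- follows from `δ ≤ L * T`.
        ⊕ 0≤S₀ ⊛ diff (T * (L * ε)) δ (cancel (T * (L * ε)) δ
          (≤-by (L * (T * (T * (L * ε)))) (L * (T * δ))
            (diff (ε * ((L * L) * (T * T))) (1ℝ * (δ * δ))
                (≃⇒≤ (ε * ((L * L) * (T * T))) (1ℝ * (δ * δ)) ε-def)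
              ⊕ 0≤δ ⊛ diff δ (L * T) δ≤LT)
            λ n → solve 4 (λ L T ε δ → L :* (T :* δ) := L :* (T :* (T :* (L :* ε))) :+
                ((con 1ℚ :* (δ :* δ) :- ε :* ((L :* L) :* (T :* T))) :+ δ :* (L :* T :- δ))) refl
              (seq L n) (seq T n) (seq ε n) (seq δ n))))
      λ n → solve 7 (λ v v̂ L T ε δ S → v̂ := (v :- δ :* S) :+
          ((v̂ :+ T :* (L :* (ε :* S)) :- v) :+ S :* (δ :- T :* (L :* ε)))) refl
        (seq v n) (seq v̂ n) (seq L n) (seq T n) (seq ε n) (seq δ n) (seq S₀ n)

    large : L * T ≤ δ → v - δ * S₀ ≤ v̂
    large LT≤δ = ≤-by (v - δ * S₀) v̂
      (diff v (L * S₀) (price-≤-linear G-bound U-returns W-returns {L} g≤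
          τ 0 (ℕ.+-identityʳ τ) ℓ S₀ 0≤S₀)
        ⊕ price-nonNeg Ĝ-bound
            (λ r r∈ → U-returns r (proj₁ r∈)) (λ r r∈ → W-returns r (proj₁ r∈)) g≥0 (- ζ₋) ζ₊
            (left∈Grid ε (- ζ₋) ζ₊ -ζ₋≤ζ₊) -ζ₋≤0
            (right∈Grid ε (- ζ₋) ζ₊ -ζ₋≤ζ₊ U-multiple) (<⇒≤ 0ℝ ζ₊ 0<ζ₊)
            τ 0 (ℕ.+-identityʳ τ) ℓ S₀ 0≤S₀
        ⊕ 0≤S₀ ⊛ diff (L * T) δ LT≤δ
        -- Here `1 ≤ τ` enters: it gives `L * S₀ ≤ L * T * S₀ ≤ δ * S₀`.
        ⊕ 0≤S₀ ⊛ (0≤L ⊛ τ-1≥0))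
      λ n → solve 6 (λ v v̂ L T δ S → v̂ := (v :- δ :* S) :+
          ((L :* S :- v) :+ v̂ :+ S :* (δ :- L :* T) :+ S :* (L :* (T :- con 1ℚ)))) refl
        (seq v n) (seq v̂ n) (seq L n) (seq T n) (seq δ n) (seq S₀ n)
  in
  ≤-by-cases δ (L * T) (v - δ * S₀) v̂ small large ,
  -- Membership in a grid contains membership in the interval as its first component, so `proj₁` is
  -- the inclusion.
  price-mono-⊆ proj₁ proj₁ Ĝ-bound G-bound τ 0 (ℕ.+-identityʳ τ) ℓ S₀
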